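{- For every integer $n\ge1$, $H(n)=p(n)-n$ is the number of non-hook partitions of $n$. Equivalently, $$H(n)=\#\{\lambda\vdash n:\operatorname{Dur}(\lambda)\ge2\}.$$
   Context: $p(n)$ denotes the number of (unrestricted) partitions of the positive integer $n$, and $H(n):=p(n)-n$. A hook partition of $n$ is a partition of the form $(k,1^{\,n-k})$ with $1\le k\le n$ (one part equal to $k$ followed by $n-k$ parts equal to $1$); a non-hook partition is one not of this form. The Durfee square of a partition $\lambda$ is the largest square contained in its Ferrers diagram (anchored at the top-left corner); $\operatorname{Dur}(\lambda)$ denotes its side length, i.e. the largest $d$ such that $\lambda$ has at least $d$ parts that are $\ge d$. -}

module Defs where

open import Data.Integer.Base as ℤ using (ℤ; +_)
open import Data.List.Base
  using (List; []; _∷_; length; filter; replicate; upTo; cartesianProductWith)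
open import Data.List.Extrema.Nat using (max; argmax-sel; xs≤max)
open import Data.List.Membership.Propositional using (_∈_)
open import Data.List.Membership.Propositional.Properties
  using (∈-cartesianProductWith⁺; ∈-cartesianProductWith⁻; ∈-filter⁺; ∈-filter⁻; ∈-upTo⁺)
open import Data.List.Properties using (length-filter; ≡-dec)
open import Data.List.Relation.Unary.All as All using (All; []; _∷_; all?)
open import Data.List.Relation.Unary.AllPairs using ([]; _∷_)
open import Data.List.Relation.Unary.Any using (here; there)
open import Data.List.Relation.Unary.Linked using (Linked; linked?)
open import Data.List.Relation.Unary.Unique.Propositional using (Unique)
import Data.List.Relation.Unary.Unique.Propositional.Properties as Unique
open import Data.Nat.Base using (ℕ; zero; suc; _∸_; _≤_; _≥_; z≤n; s≤s)
open import Data.Nat.ListAction using (sum)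
open import Data.Nat.Properties
  using (_≟_; _≤?_; _≥?_; ≤-trans; +-mono-≤; m≤m+n; m≤n+m)
open import Data.Product.Base using (∃-syntax; _×_; _,_; proj₂)
open import Data.Sum.Base using (inj₁; inj₂)
open import Function.Base using (id)
open import Function.Bundles using (_⇔_; mk⇔; Equivalence)
open import Relation.Binary.PropositionalEquality.Core using (_≡_; refl; sym; subst)
open import Relation.Nullary.Decidable using (Dec; no; map′; ¬?; _×-dec_)
open import Relation.Nullary.Negation.Core using (¬_)
open import Relation.Unary using (Pred; Decidable; _∩_)
open import Level using (0ℓ)

-- The number of elements satisfying P is the length of any duplicate-free
-- list whose members are exactly those elements.

record Enumeration {A : Set} (P : Pred A 0ℓ) : Set where
  field
    list   : List A
    unique : Unique list
    ∈⇔     : ∀ x → x ∈ list ⇔ P x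

#_ : {A : Set} {P : Pred A 0ℓ} → Enumeration P → ℕ
# e = length (Enumeration.list e)

restrict : {A : Set} {P Q : Pred A 0ℓ} →
           Decidable Q → Enumeration P → Enumeration (P ∩ Q)
restrict Q? e = record
  { list   = filter Q? list
  ; unique = Unique.filter⁺ Q? unique
  ; ∈⇔     = λ x → mk⇔
      (λ x∈ → let x∈′ , q = ∈-filter⁻ Q? {xs = list} x∈ in Equivalence.to (∈⇔ x) x∈′ , q)
      (λ (p , q) → ∈-filter⁺ Q? (Equivalence.from (∈⇔ x) p) q)
  } where open Enumeration e

infix 4 _⊢_ _⊢?_

record _⊢_ (ps : List ℕ) (n : ℕ) : Set where
  constructor partition
  field
    decreasing : Linked _≥_ ps
    positive   : All (1 ≤_) ps
    total      : sum ps ≡ n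

_⊢?_ : ∀ ps n → Dec (ps ⊢ n)
ps ⊢? n = map′
  (λ (d , p , t) → partition d p t)
  (λ (partition d p t) → d , p , t)
  (linked? _≥?_ ps ×-dec all? (1 ≤?_) ps ×-dec sum ps ≟ n)

lists≤ : List ℕ → ℕ → List (List ℕ)
lists≤ as zero    = [] ∷ []
lists≤ as (suc ℓ) = [] ∷ cartesianProductWith _∷_ as (lists≤ as ℓ)

private
  ∷-inj : ∀ {w x : ℕ} {y z : List ℕ} → w ∷ y ≡ x ∷ z → w ≡ x × y ≡ z
  ∷-inj refl = refl , refl

  lists≤-unique : ∀ {as} → Unique as → ∀ ℓ → Unique (lists≤ as ℓ)
  lists≤-unique     u zero    = [] ∷ []
  lists≤-unique {as} u (suc ℓ) =
    All.tabulate (λ y∈ []≡y → nil∉ (subst (_∈ _) (sym []≡y) y∈))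
    ∷ Unique.cartesianProductWith⁺ _∷_ ∷-inj u (lists≤-unique u ℓ)
    where
    nil∉ : ¬ [] ∈ cartesianProductWith _∷_ as (lists≤ as ℓ)
    nil∉ []∈ with ∈-cartesianProductWith⁻ _∷_ as (lists≤ as ℓ) []∈
    ... | _ , _ , _ , _ , ()

  lists≤-complete : ∀ {as} ps ℓ → length ps ≤ ℓ → All (_∈ as) ps → ps ∈ lists≤ as ℓ
  lists≤-complete []       zero    _         _         = here refl
  lists≤-complete []       (suc ℓ) _         _         = here refl
  lists≤-complete (p ∷ ps) (suc ℓ) (s≤s len) (p∈ ∷ ps∈) =
    there (∈-cartesianProductWith⁺ _∷_ p∈ (lists≤-complete ps ℓ len ps∈))

  length≤sum : ∀ {ps} → All (1 ≤_) ps → length ps ≤ sum ps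
  length≤sum []       = z≤n
  length≤sum (p ∷ ps) = +-mono-≤ p (length≤sum ps)

  parts≤sum : ∀ ps → All (_≤ sum ps) ps
  parts≤sum []       = []
  parts≤sum (p ∷ ps) =
    m≤m+n p (sum ps) ∷ All.map (λ q≤ → ≤-trans q≤ (m≤n+m (sum ps) p)) (parts≤sum ps)

-- A partition of n has at most n parts, none of them larger than n.
partitions : ∀ n → Enumeration (_⊢ n)
partitions n = record
  { list   = filter (_⊢? n) candidates
  ; unique = Unique.filter⁺ (_⊢? n) (lists≤-unique (Unique.upTo⁺ (suc n)) n)
  ; ∈⇔     = λ ps → mk⇔
      (λ ps∈ → proj₂ (∈-filter⁻ (_⊢? n) {xs = candidates} ps∈))
      (λ ps⊢n → ∈-filter⁺ (_⊢? n) (complete ps⊢n) ps⊢n)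
  }
  where
  candidates = lists≤ (upTo (suc n)) n

  complete : ∀ {ps} → ps ⊢ n → ps ∈ candidates
  complete {ps} (partition _ pos refl) =
    lists≤-complete ps n (length≤sum pos) (All.map (λ q≤ → ∈-upTo⁺ (s≤s q≤)) (parts≤sum ps))

p : ℕ → ℕ
p n = # partitions n

-- Integer-valued, so that the subtraction is not truncated.
H : ℕ → ℤ
H n = + p n ℤ.- + n

IsHook : ℕ → List ℕ → Set
IsHook n ps = ∃[ k ] 1 ≤ k × k ≤ n × ps ≡ k ∷ replicate (n ∸ k) 1

isHook? : ∀ n → Decidable (IsHook n)
isHook? n []       = no λ ()
isHook? n (k ∷ ps) = map′
  (λ { (1≤k , k≤n , refl) → k , 1≤k , k≤n , refl })
  (λ { (_ , 1≤k , k≤n , refl) → 1≤k , k≤n , refl })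
  (1 ≤? k ×-dec k ≤? n ×-dec ≡-dec _≟_ ps (replicate (n ∸ k) 1))

nonHookPartitions : ∀ n → Enumeration (λ ps → ps ⊢ n × ¬ IsHook n ps)
nonHookPartitions n = restrict (λ ps → ¬? (isHook? n ps)) (partitions n)

-- Equivalently, the d × d square fits in the top-left corner of the Ferrers
-- diagram of ps.
HasSquare : List ℕ → ℕ → Set
HasSquare ps d = d ≤ length (filter (d ≤?_) ps)

hasSquare? : ∀ ps → Decidable (HasSquare ps)
hasSquare? ps d = d ≤? length (filter (d ≤?_) ps)

-- The search stops at length ps because HasSquare ps d forces d ≤ length ps;
-- Dur-square and Dur-greatest confirm that nothing is lost.
Dur : List ℕ → ℕ
Dur ps = max 0 (filter (hasSquare? ps) (upTo (suc (length ps))))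

Dur-square : ∀ ps → HasSquare ps (Dur ps)
Dur-square ps with argmax-sel id 0 (filter (hasSquare? ps) (upTo (suc (length ps))))
... | inj₁ ≡0 = subst (HasSquare ps) (sym ≡0) z≤n
... | inj₂ ∈sq = proj₂ (∈-filter⁻ (hasSquare? ps) {xs = upTo (suc (length ps))} ∈sq)

Dur-greatest : ∀ ps d → HasSquare ps d → d ≤ Dur ps
Dur-greatest ps d sq =
  All.lookup (xs≤max 0 (filter (hasSquare? ps) (upTo (suc (length ps)))))
    (∈-filter⁺ (hasSquare? ps) (∈-upTo⁺ (s≤s (≤-trans sq (length-filter (d ≤?_) ps)))) sq)

durfee≥2Partitions : ∀ n → Enumeration (λ ps → ps ⊢ n × Dur ps ≥ 2)
durfee≥2Partitions n = restrict (λ ps → Dur ps ≥? 2) (partitions n)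

-- Whether a partition is a hook depends only on its second part: if that part is
-- at least 2, so is the first, and the 2 × 2 square fits; otherwise all parts
-- after the first equal 1.  There is exactly one hook for each first part
-- 1 ≤ k ≤ n, so n of the p(n) partitions are hooks.

module Submission where

open import Defs
open import Data.Integer.Base using (+_; _⊖_)
open import Data.Integer.Properties using (m-n≡m⊖n; ⊖-≥)
open import Data.List.Base using (List; []; _∷_; length; filter; replicate; upTo; map)
open import Data.List.Membership.Propositional.Properties
  using (∈-map⁺; ∈-map⁻; ∈-upTo⁺; ∈-upTo⁻)
open import Data.List.Membership.Propositional.Properties.WithK using (unique∧set⇒bag)
open import Data.List.Properties
  using (∷-injectiveˡ; length-map; length-upTo; filter-accept; filter-none)
open import Data.List.Relation.Binary.BagAndSetEquality using (∼bag⇒↭)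
open import Data.List.Relation.Binary.Permutation.Propositional.Properties using (↭-length)
open import Data.List.Relation.Binary.Sublist.Propositional using (⊆-refl)
open import Data.List.Relation.Binary.Sublist.Propositional.Properties
  using (filter⁺; length-mono-≤)
open import Data.List.Relation.Unary.All using (All; []; _∷_)
open import Data.List.Relation.Unary.All.Properties using (replicate⁺)
open import Data.List.Relation.Unary.Linked using (Linked; [-]; _∷_)
open import Data.List.Relation.Unary.Linked.Properties using (Linked⇒All)
import Data.List.Relation.Unary.Unique.Propositional.Properties as Unique
open import Data.Nat.Base using (ℕ; zero; suc; _+_; _∸_; _≤_; _≥_; z≤n; s≤s)
open import Data.Nat.ListAction using (sum)
open import Data.Nat.Properties
open import Data.Product.Base using (_×_; _,_; proj₁; proj₂)
open import Data.Sum.Base using (_⊎_; inj₁; inj₂)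
open import Function.Base using (_∘_; flip)
open import Function.Bundles using (_⇔_; mk⇔; Equivalence)
open import Level using (0ℓ)
open import Relation.Binary.PropositionalEquality
open import Relation.Nullary.Decidable using (yes; no; ¬?)
open import Relation.Nullary.Negation.Core using (¬_; contradiction)
open import Relation.Unary using (Pred; Decidable; ∁; _≐_)

private
  variable
    A : Set
    P Q : Pred A 0ℓ
    k n : ℕ
    ps : List ℕ

-- Two duplicate-free lists with the same members are permutations of each other, so a count depends
-- on the predicate only, not on how it is enumerated.
#-cong : (d : Enumeration P) (e : Enumeration Q) → P ≐ Q → # d ≡ # e
#-cong d e (P⊆Q , Q⊆P) = ↭-length (∼bag⇒↭ (unique∧set⇒bag D.unique E.unique
  (λ {x} → mk⇔ (from (E.∈⇔ x) ∘ P⊆Q ∘ to (D.∈⇔ x)) (from (D.∈⇔ x) ∘ Q⊆P ∘ to (E.∈⇔ x)))))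
  where
  module D = Enumeration d
  module E = Enumeration e
  open Equivalence

length-filter-∁ : (P? : Decidable P) (xs : List A) →
                  length (filter P? xs) + length (filter (¬? ∘ P?) xs) ≡ length xs
length-filter-∁ P? []       = refl
length-filter-∁ P? (x ∷ xs) with P? x
... | yes _ = cong suc (length-filter-∁ P? xs)
... | no  _ = trans (+-suc _ _) (cong suc (length-filter-∁ P? xs))

sum-replicate-1 : ∀ m → sum (replicate m 1) ≡ m
sum-replicate-1 zero    = refl
sum-replicate-1 (suc m) = cong suc (sum-replicate-1 m)

-- Each part is squeezed to 1, so the sum counts the parts.
replicate-1-unique : All (1 ≤_) ps → All (_≤ 1) ps → ps ≡ replicate (sum ps) 1
replicate-1-unique []        []        = refl
replicate-1-unique (1≤p ∷ l) (p≤1 ∷ u) with refl ← ≤-antisym p≤1 1≤p =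
  cong (1 ∷_) (replicate-1-unique l u)

hook-decreasing : 1 ≤ k → ∀ m → Linked _≥_ (k ∷ replicate m 1)
hook-decreasing 1≤k zero    = [-]
hook-decreasing 1≤k (suc m) = 1≤k ∷ hook-decreasing ≤-refl m

-- `IsHook` prescribes only a shape; this ensures that every hook occurs among the partitions of
-- `n`.
hook-⊢ : IsHook n ps → ps ⊢ n
hook-⊢ {n} (k , 1≤k , k≤n , refl) = partition
  (hook-decreasing 1≤k (n ∸ k))
  (1≤k ∷ replicate⁺ (n ∸ k) ≤-refl)
  (trans (cong (λ m → k + m) (sum-replicate-1 (n ∸ k))) (m+[n∸m]≡n k≤n))

hooks : ∀ n → Enumeration (IsHook n)
hooks n = record
  { list   = map hook (upTo n)
  ; unique = Unique.map⁺ (suc-injective ∘ ∷-injectiveˡ) (Unique.upTo⁺ n)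
  ; ∈⇔     = λ ps → mk⇔
      (λ ps∈ → let k , k∈ , eq = ∈-map⁻ hook ps∈ in suc k , s≤s z≤n , ∈-upTo⁻ k∈ , eq)
      (λ { (suc k , _ , k<n , refl) → ∈-map⁺ hook (∈-upTo⁺ k<n) })
  }
  where
  hook : ℕ → List ℕ
  -- `upTo n` starts at 0, so the shift by one makes the first part run through 1, ..., `n`; this
  -- part already tells the hooks apart.
  hook k = suc k ∷ replicate (n ∸ suc k) 1

#hooks : ∀ n → # hooks n ≡ n
#hooks n = trans (length-map _ (upTo n)) (length-upTo n)

n+#nonHook≡p : ∀ n → n + # nonHookPartitions n ≡ p n
n+#nonHook≡p n = begin
  n + # nonHookPartitions n
    ≡⟨ cong (_+ # nonHookPartitions n) (#hooks n) ⟨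
  # hooks n + # nonHookPartitions n
    -- Replaces the explicit list of hooks by the hooks filtered out of all partitions, so that both
    -- summands split the same list.
    ≡⟨ cong (_+ # nonHookPartitions n)
         (#-cong (hooks n) (restrict (isHook? n) (partitions n))
           ((λ h → hook-⊢ h , h) , proj₂)) ⟩
  # restrict (isHook? n) (partitions n) + # nonHookPartitions n
    ≡⟨ length-filter-∁ (isHook? n) (Enumeration.list (partitions n)) ⟩
  p n ∎
  where open ≡-Reasoning

H≡#nonHook : ∀ n → H n ≡ + (# nonHookPartitions n)
H≡#nonHook n = begin
  H n                                 ≡⟨ m-n≡m⊖n (p n) n ⟩
  p n ⊖ n                             ≡⟨ cong (_⊖ n) (n+#nonHook≡p n) ⟨
  -- Written as this sum, `p n` is visibly at least `n`, so the integer difference is a natural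
  -- number.
  (n + # nonHookPartitions n) ⊖ n     ≡⟨ ⊖-≥ (m≤m+n n _) ⟩
  + (n + # nonHookPartitions n ∸ n)   ≡⟨ cong +_ (m+n∸m≡n n _) ⟩
  + (# nonHookPartitions n)           ∎
  where open ≡-Reasoning

-- Parts that are at least `d` are at least `c`, so one filtered list is a sublist of the other.
hasSquare-downward : ∀ ps {c d} → c ≤ d → HasSquare ps d → HasSquare ps c
hasSquare-downward ps {c} {d} c≤d sq = ≤-trans c≤d (≤-trans sq
  (length-mono-≤ (filter⁺ (d ≤?_) (c ≤?_) (λ { refl → ≤-trans c≤d }) (⊆-refl {x = ps}))))

Dur≥⇔hasSquare : ∀ ps d → Dur ps ≥ d ⇔ HasSquare ps d
Dur≥⇔hasSquare ps d =
  mk⇔ (λ d≤ → hasSquare-downward ps d≤ (Dur-square ps)) (Dur-greatest ps d)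

length-filter-∷ : (P? : Decidable P) (x : A) (xs : List A) →
                  length (filter P? (x ∷ xs)) ≤ suc (length (filter P? xs))
length-filter-∷ P? x xs with P? x
... | yes _ = ≤-refl
... | no  _ = n≤1+n _

-- Only the first part of a hook can reach 2, whereas the square needs two such parts.
hook⇒¬square : IsHook n ps → ¬ HasSquare ps 2
hook⇒¬square {n} (k , _ , _ , refl) sq = <-irrefl refl (begin-strict
  1                                      <⟨ sq ⟩
  length (filter (2 ≤?_) (k ∷ ones))     ≤⟨ length-filter-∷ (2 ≤?_) k ones ⟩
  suc (length (filter (2 ≤?_) ones))     ≡⟨ cong (suc ∘ length) (filter-none (2 ≤?_) no-2s) ⟩
  1                                      ∎)
  where
  open ≤-Reasoning

  ones : List ℕ
  ones = replicate (n ∸ k) 1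

  no-2s : All (∁ (2 ≤_)) ones
  no-2s = replicate⁺ (n ∸ k) (<-irrefl refl)

square⊎small-tail : Linked _≥_ (k ∷ ps) → HasSquare (k ∷ ps) 2 ⊎ All (_≤ 1) ps
square⊎small-tail [-] = inj₂ []
square⊎small-tail {k} {l ∷ qs} (l≤k ∷ dec) with 2 ≤? l
-- The parts decrease weakly, so the bound 1 on the second part passes to all later ones.
... | no  2≰l = inj₂ (Linked⇒All (flip ≤-trans) (≤-pred (≰⇒> 2≰l)) dec)
... | yes 2≤l = inj₁ (subst (λ rs → 2 ≤ length rs) (sym two) (s≤s (s≤s z≤n)))
  where
  two : filter (2 ≤?_) (k ∷ l ∷ qs) ≡ k ∷ l ∷ filter (2 ≤?_) qs
  two = trans (filter-accept (2 ≤?_) (≤-trans 2≤l l≤k))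
              (cong (k ∷_) (filter-accept (2 ≤?_) 2≤l))

square⊎hook : n ≥ 1 → ps ⊢ n → HasSquare ps 2 ⊎ IsHook n ps
-- The empty partition has neither property; it occurs only for `n = 0`.
square⊎hook {ps = []}     ()  (partition _ _ refl)
square⊎hook {ps = k ∷ ps} n≥1 (partition dec (1≤k ∷ pos) refl) with square⊎small-tail dec
... | inj₁ sq    = inj₁ sq
-- Here `n` is `k + sum ps`, so the `sum ps` ones of the tail number `n ∸ k`, as a hook requires.
... | inj₂ small = inj₂ (k , 1≤k , m≤m+n k (sum ps) , cong (k ∷_)
  (trans (replicate-1-unique pos small)
         (cong (λ m → replicate m 1) (sym (m+n∸m≡n k (sum ps))))))

nonHook≐durfee≥2 : n ≥ 1 → (λ ps → ps ⊢ n × ¬ IsHook n ps) ≐ (λ ps → ps ⊢ n × Dur ps ≥ 2)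
nonHook≐durfee≥2 n≥1 = nonHook⊆ , ⊆nonHook
  where
  open Equivalence

  nonHook⊆ : ∀ {ps} → ps ⊢ _ × ¬ IsHook _ ps → ps ⊢ _ × Dur ps ≥ 2
  nonHook⊆ {ps} (ps⊢n , ¬hook) with square⊎hook n≥1 ps⊢n
  ... | inj₁ sq   = ps⊢n , from (Dur≥⇔hasSquare ps 2) sq
  ... | inj₂ hook = contradiction hook ¬hook

  ⊆nonHook : ∀ {ps} → ps ⊢ _ × Dur ps ≥ 2 → ps ⊢ _ × ¬ IsHook _ ps
  ⊆nonHook {ps} (ps⊢n , dur) = ps⊢n , λ hook →
    hook⇒¬square hook (to (Dur≥⇔hasSquare ps 2) dur)

proposition2p1 : (n : ℕ) → n ≥ 1 →
    (H n ≡ + (# nonHookPartitions n)) × (H n ≡ + (# durfee≥2Partitions n))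
proposition2p1 n n≥1 = H≡#nonHook n , trans (H≡#nonHook n)
  (cong +_ (#-cong (nonHookPartitions n) (durfee≥2Partitions n) (nonHook≐durfee≥2 n≥1)))
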